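{- Let $\mathbf d=(d_1,\ldots,d_t)$ be a nonincreasing graphic sequence with $d_1=D>0$, and let $\mathbf d'$ be its Havel--Hakimi reduction. Then \[ \operatorname{CW}(\mathbf d')-\operatorname{CW}(\mathbf d)=\sum_{i=2}^{D+1}\frac{1}{d_i(d_i+1)}-\frac{1}{D+1}\ \ge\ 0 . \] Moreover, \[ \operatorname{CW}(\mathbf d')-\operatorname{CW}(\mathbf d)=\sum_{i=2}^{D+1}\frac{(D-d_i)(D+d_i+1)}{d_i(d_i+1)D(D+1)} . \] Consequently, if $\mathbf d^{(0)}=\mathbf d,\mathbf d^{(1)},\ldots,\mathbf d^{(s)}$ is the complete Havel--Hakimi trajectory of $\mathbf d$, with $\mathbf d^{(s)}$ consisting of $\operatorname{R}(\mathbf d)$ zeros, then \[ \operatorname{R}(\mathbf d)-\operatorname{CW}(\mathbf d)=\sum_{j=0}^{s-1}\left(\sum_{i=2}^{D_j+1}\frac{1}{d_i^{(j)}(d_i^{(j)}+1)}-\frac{1}{D_j+1}\right), \] where $D_j=d_1^{(j)}$.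
   Context: A finite sequence of nonnegative integers is graphic if it is the degree sequence of a finite simple graph. For a nonincreasing graphic sequence $\mathbf d=(d_1,\ldots,d_t)$ with $d_1=D>0$, its Havel--Hakimi reduction $\mathbf d'$ is obtained by deleting $d_1=D$ (the pivot), subtracting one from each of $d_2,\ldots,d_{D+1}$ (the selected entries, which are positive by graphicality), and reordering in nonincreasing order; $\mathbf d'$ is again graphic. Repeated reduction while the largest term is positive gives the complete trajectory $\mathbf d^{(0)},\ldots,\mathbf d^{(s)}$, ending at an all-zero sequence $\mathbf d^{(s)}$; $\operatorname{R}(\mathbf d)$ is the number of its zeros. The Caro--Wei sum is $\operatorname{CW}(\mathbf d)=\sum_i \frac{1}{d_i+1}$. -}

module Defs where

open import Data.Bool.Base using (Bool; false)
open import Data.Fin.Base using (Fin)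
open import Data.Fin.Subset using (Subset; ∣_∣)
open import Data.Integer.Base as ℤ using (ℤ; +_; 1ℤ)
open import Data.List.Base using (List; []; _∷_; _++_; drop; filter; foldr; length; lookup; map; take)
open import Data.List.Relation.Unary.All using (All)
open import Data.Nat.Base as ℕ using (ℕ; zero; suc; pred; _<_)
open import Data.Nat.GeneralisedArithmetic using (fold)
open import Data.Nat.Properties using (_≟_; ≤-decTotalOrder)
open import Data.Product.Base using (∃)
open import Data.Rational.Base using (ℚ; 0ℚ; _/_; _+_; _-_)
open import Data.Vec.Base using (tabulate)
open import Relation.Binary.Bundles using (DecTotalOrder)
open import Relation.Binary.Construct.Flip.EqAndOrd using (decTotalOrder)
open import Relation.Binary.PropositionalEquality.Core using (_≡_)

≥-decTotalOrder : DecTotalOrder _ _ _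
≥-decTotalOrder = decTotalOrder ≤-decTotalOrder

open import Data.List.Sort ≥-decTotalOrder using (sort)
open import Data.List.Relation.Unary.Sorted.TotalOrder (DecTotalOrder.totalOrder ≥-decTotalOrder) public
  using () renaming (Sorted to Nonincreasing)

record SimpleGraph (n : ℕ) : Set where
  field
    adjacent    : Fin n → Fin n → Bool
    symmetric   : ∀ u v → adjacent u v ≡ adjacent v u
    irreflexive : ∀ v → adjacent v v ≡ false

  neighbours : Fin n → Subset n
  neighbours v = tabulate (adjacent v)

  degree : Fin n → ℕ
  degree v = ∣ neighbours v ∣

Graphic : List ℕ → Set
Graphic d = ∃ λ (G : SimpleGraph (length d)) → ∀ v → SimpleGraph.degree G v ≡ lookup d v

-- The first entry, which is the largest one when the sequence is nonincreasing.
-- The value on the empty sequence is a convention: nothing is left to reduce.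
pivot : List ℕ → ℕ
pivot []      = 0
pivot (D ∷ _) = D

-- The entries d₂, …, d_{D+1}.  `take` silently stops at the end of the list;
-- `WellDefinedStep` below records that this does not happen.
selected : List ℕ → List ℕ
selected []       = []
selected (D ∷ ds) = take D ds

reduction : List ℕ → List ℕ
reduction []       = []
reduction (D ∷ ds) = sort (map pred (take D ds) ++ drop D ds)

record WellDefinedStep (d : List ℕ) : Set where
  field
    pivot-positive    : 0 < pivot d
    selected-length   : length (selected d) ≡ pivot d
    selected-positive : All (0 <_) (selected d)

-- d ^⟨ j ⟩ is the sequence obtained from d by j reductions.
_^⟨_⟩ : List ℕ → ℕ → List ℕ
d ^⟨ j ⟩ = fold d reduction j

-- The number s of reductions performed until the pivot is zero.  Each reduction
-- shortens the sequence by one entry, so `length d` is a sufficient bound.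
stepsWithin : ℕ → List ℕ → ℕ
stepsWithin zero    d = 0
stepsWithin (suc k) d with pivot d
... | zero  = 0
... | suc _ = suc (stepsWithin k (reduction d))

steps : List ℕ → ℕ
steps d = stepsWithin (length d) d

zeros : List ℕ → ℕ
zeros d = length (filter (_≟ 0) d)

R : List ℕ → ℕ
R d = zeros (d ^⟨ steps d ⟩)

infix 5 ∑-syntax

∑-syntax : List ℕ → (ℕ → ℚ) → ℚ
∑-syntax xs f = foldr (λ x acc → f x + acc) 0ℚ xs

syntax ∑-syntax xs (λ x → e) = ∑[ x ∈ xs ] e

infixl 7 _÷_

-- Division extended by p ÷ 0 = 0.
_÷_ : ℤ → ℕ → ℚ
p ÷ zero  = 0ℚ
p ÷ suc q = p / suc q

CW : List ℕ → ℚ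
CW d = ∑[ x ∈ d ] (1ℤ / suc x)

gain : List ℕ → ℚ
gain d = (∑[ x ∈ selected d ] (1ℤ ÷ (x ℕ.* (x ℕ.+ 1)))) - 1ℤ / suc (pivot d)

-- The numerator is an integer product, so D - x is not truncated.
factoredGain : List ℕ → ℚ
factoredGain d = ∑[ x ∈ selected d ]
  (((+ D ℤ.- + x) ℤ.* + (D ℕ.+ x ℕ.+ 1)) ÷ (x ℕ.* (x ℕ.+ 1) ℕ.* D ℕ.* (D ℕ.+ 1)))
  where
  D : ℕ
  D = pivot d

{-# OPTIONS --safe #-}
module Submission where

-- A graph is described by deleting its vertices one at a time, so that a degree sequence k ∷ ds arises
-- from a degree sequence by adding one to k of its entries.  If vertex i has larger degree than vertex j,
-- some neighbour of i (other than j) is not adjacent to j, and moving that edge from i to j transfers one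
-- unit of degree.  Such transfers turn the neighbours of the pivot into the D largest other vertices,
-- which is the Havel–Hakimi theorem.  The formulas for CW then follow from
--   1/x = 1/(x+1) + 1/(x(x+1))   and   1/(x(x+1)) = (D-x)(D+x+1)/(x(x+1)D(D+1)) + 1/(D(D+1)),
-- the D copies of the last term adding up to 1/(D+1).

open import Defs
open import Data.Bool.Base using (Bool; true; false; if_then_else_)
open import Data.Fin.Base using (Fin; zero; suc)
open import Data.Fin.Subset using (∣_∣)
open import Data.Integer.Base as ℤ using (+_; 1ℤ)
import Data.Integer.Properties as ℤ
import Data.Integer.Tactic.RingSolver as ℤSolver
open import Data.List.Base using (List; []; _∷_; _++_; drop; length; map; replicate; tabulate; take; upTo)
open import Data.List.Membership.Propositional using (_∈_)
import Data.List.Properties as List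
open import Data.List.Relation.Binary.Permutation.Propositional
  using (_↭_; refl; prep; swap; trans; ↭-sym)
open import Data.List.Relation.Binary.Permutation.Propositional.Properties using (++⁺ʳ; shift)
open import Data.List.Relation.Unary.All as All using (All; []; _∷_)
open import Data.List.Relation.Unary.All.Properties using (take⁺)
open import Data.List.Relation.Unary.AllPairs using (AllPairs; _∷_)
open import Data.List.Relation.Unary.Any using (here; there)
open import Data.List.Relation.Unary.Linked.Properties using (Linked⇒AllPairs)
open import Data.List.Sort ≥-decTotalOrder using (sort-↭; sort-↗)
open import Data.Nat.Base as ℕ using (ℕ; zero; suc; pred; _≥_; _<_; z≤n; s≤s; z<s; NonZero)
open import Data.Nat.Properties using (≤-refl; ≤-trans; <⇒≤; m<n⇒m<1+n)
open import Data.Product.Base using (_×_; _,_; ∃; ∃₂; proj₂)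
open import Data.Rational.Base using (ℚ; 0ℚ; _/_; _+_; _-_; _≤_; fromℚᵘ; toℚᵘ)
import Data.Rational.Properties as ℚ
open import Data.Rational.Solver using (module +-*-Solver)
open import Data.Rational.Unnormalised.Base as ℚᵘ using (mkℚᵘ; *≡*)
import Data.Rational.Unnormalised.Properties as ℚᵘ
import Data.Vec.Base as Vec
open import Function.Base using (_∘_)
open import Relation.Binary.PropositionalEquality as ≡ using (_≡_; cong; cong₂; subst; module ≡-Reasoning)

private variable
  j k n x y : ℕ
  xs ys zs ds ctx : List ℕ

-- Degree sequences built vertex by vertex.

data Raise : ℕ → List ℕ → List ℕ → Set where
  []    : Raise 0 [] []
  raise : Raise k ys ds → Raise (suc k) (y ∷ ys) (suc y ∷ ds)
  keep  : Raise k ys ds → Raise k (y ∷ ys) (y ∷ ds)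

-- The number of vertices is an index because `Realizable-↭` recurses on it: its `trans` case shrinks the
-- permutation but not the derivation.
data Realizable : ℕ → List ℕ → Set where
  []  : Realizable 0 []
  add : Raise k ys ds → Realizable n ys → Realizable (suc n) (k ∷ ds)

-- The Boolean adjacency row `b` of one vertex is a choice of `raise` or `keep` at each other
-- vertex.
Raise-tabulate : ∀ {n} (b : Fin n → Bool) (f g : Fin n → ℕ) →
                 (∀ v → g v ≡ (if b v then suc (f v) else f v)) →
                 Raise ∣ Vec.tabulate b ∣ (tabulate f) (tabulate g)
Raise-tabulate {zero} b f g eq = []
Raise-tabulate {suc n} b f g eq with b zero | eq zero
... | true  | eq₀ rewrite eq₀ = raise (Raise-tabulate (b ∘ suc) (f ∘ suc) (g ∘ suc) (eq ∘ suc))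
... | false | eq₀ rewrite eq₀ = keep (Raise-tabulate (b ∘ suc) (f ∘ suc) (g ∘ suc) (eq ∘ suc))

degrees-realizable : ∀ {n} (G : SimpleGraph n) → Realizable n (tabulate (SimpleGraph.degree G))
degrees-realizable {zero} G = []
degrees-realizable {suc n} G = subst (λ k → Realizable (suc n) (k ∷ tabulate (degree ∘ suc))) (≡.sym head-degree)
  (add (Raise-tabulate (adjacent zero ∘ suc) G′.degree (degree ∘ suc) tail-degree)
       (degrees-realizable G′))
  where
  open SimpleGraph G
  G′ : SimpleGraph n
  G′ = record
    { adjacent    = λ u v → adjacent (suc u) (suc v)
    ; symmetric   = λ u v → symmetric (suc u) (suc v)
    ; irreflexive = λ v → irreflexive (suc v)
    }
  module G′ = SimpleGraph G′

  head-degree : degree zero ≡ ∣ Vec.tabulate (adjacent zero ∘ suc) ∣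
  head-degree rewrite irreflexive zero = ≡.refl

  -- The edge to `zero` is counted in the row of `suc v`; symmetry reads it in the row of `zero`,
  -- which `Raise-tabulate` follows.
  tail-degree : ∀ v → degree (suc v) ≡ (if adjacent zero (suc v) then suc (G′.degree v) else G′.degree v)
  tail-degree v rewrite symmetric (suc v) zero with adjacent zero (suc v)
  ... | true  = ≡.refl
  ... | false = ≡.refl

graphic-realizable : ∀ {d} → Graphic d → Realizable (length d) d
graphic-realizable {d} (G , degree≡d) = subst (Realizable (length d))
  (≡.trans (List.tabulate-cong degree≡d) (List.tabulate-lookup d)) (degrees-realizable G)

-- Reordering vertices and moving edges.

Raise-↭ : Raise k ys ds → ds ↭ xs → ∃ λ ys′ → Raise k ys′ xs × ys ↭ ys′
Raise-↭ r refl = _ , r , refl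
Raise-↭ (raise r) (prep _ p) with _ , r′ , q ← Raise-↭ r p = _ , raise r′ , prep _ q
Raise-↭ (keep r) (prep _ p) with _ , r′ , q ← Raise-↭ r p = _ , keep r′ , prep _ q
Raise-↭ (raise (raise r)) (swap _ _ p) with _ , r′ , q ← Raise-↭ r p = _ , raise (raise r′) , swap _ _ q
Raise-↭ (raise (keep r)) (swap _ _ p) with _ , r′ , q ← Raise-↭ r p = _ , keep (raise r′) , swap _ _ q
Raise-↭ (keep (raise r)) (swap _ _ p) with _ , r′ , q ← Raise-↭ r p = _ , raise (keep r′) , swap _ _ q
Raise-↭ (keep (keep r)) (swap _ _ p) with _ , r′ , q ← Raise-↭ r p = _ , keep (keep r′) , swap _ _ q
Raise-↭ r (trans p₁ p₂) with _ , r₁ , q₁ ← Raise-↭ r p₁ with _ , r₂ , q₂ ← Raise-↭ r₁ p₂ =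
  _ , r₂ , trans q₁ q₂

Raise-comm : Raise k ys xs → Raise j zs ys → ∃ λ ys′ → Raise j ys′ xs × Raise k zs ys′
Raise-comm [] [] = _ , [] , []
Raise-comm (raise r) (raise s) with _ , s′ , r′ ← Raise-comm r s = _ , raise s′ , raise r′
Raise-comm (raise r) (keep s) with _ , s′ , r′ ← Raise-comm r s = _ , keep s′ , raise r′
Raise-comm (keep r) (raise s) with _ , s′ , r′ ← Raise-comm r s = _ , raise s′ , keep r′
Raise-comm (keep r) (keep s) with _ , s′ , r′ ← Raise-comm r s = _ , keep s′ , keep r′

-- The head of the outer row records whether the first two vertices are adjacent. This is symmetric
-- and stays, while `Raise-comm` interchanges their rows towards the rest.
Realizable-swap : Realizable n (x ∷ y ∷ xs) → Realizable n (y ∷ x ∷ xs)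
Realizable-swap (add (raise r) (add s g)) with _ , s′ , r′ ← Raise-comm r s = add (raise s′) (add r′ g)
Realizable-swap (add (keep r) (add s g)) with _ , s′ , r′ ← Raise-comm r s = add (keep s′) (add r′ g)

Realizable-↭ : ∀ n → Realizable n xs → xs ↭ ys → Realizable n ys
Realizable-prep : ∀ n → Realizable n (x ∷ xs) → xs ↭ ys → Realizable n (x ∷ ys)

Realizable-↭ n g refl = g
Realizable-↭ n g (prep x p) = Realizable-prep n g p
Realizable-↭ (suc n) g (swap x y p) with add r g′ ← Realizable-swap g
  with _ , r′ , q ← Raise-↭ r (prep x p) = add r′ (Realizable-↭ n g′ q)
Realizable-↭ n g (trans p₁ p₂) = Realizable-↭ n (Realizable-↭ n g p₁) p₂

Realizable-prep (suc n) (add r g) p with _ , r′ , q ← Raise-↭ r p = add r′ (Realizable-↭ n g q)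

-- The edge from the first vertex to a vertex it sees, but the second does not, is handed to the second.
exchange : Raise (suc k) ys xs → Raise j zs ys → j ℕ.≤ k →
           ∃ λ ys′ → Raise k ys′ xs × Raise (suc j) zs ys′
exchange (raise r) (keep s) _ = _ , keep r , raise s
exchange (raise r) (raise s) (s≤s j≤k) with _ , r′ , s′ ← exchange r s j≤k = _ , raise r′ , raise s′
exchange (keep r) (raise s) j<k with _ , r′ , s′ ← exchange r s (<⇒≤ j<k) = _ , keep r′ , raise s′
exchange (keep r) (keep s) j≤k with _ , r′ , s′ ← exchange r s j≤k = _ , keep r′ , keep s′

-- An edge between the two vertices counts once in each degree. So in either case the first has more
-- neighbours among the remaining vertices than the second, as `exchange` requires.
transfer : Realizable n (suc x ∷ y ∷ xs) → y ℕ.≤ x → Realizable n (x ∷ suc y ∷ xs)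
transfer (add (raise r) (add s g)) (s≤s y≤x) with _ , r′ , s′ ← exchange r s y≤x = add (raise r′) (add s′ g)
transfer (add (keep r) (add s g)) y≤x
  with _ , r′ , s′ ← exchange r s y≤x = add (keep r′) (add s′ g)

-- Undoes the raise of the first raised entry, whose value before it is `z`. The membership of
-- `suc z` lets sortedness compare it with a leading entry.
lower-one : Raise (suc k) ys ds → ∃₂ λ z zs → ∃ λ ys′ →
            Raise k ys′ ds × ys ↭ z ∷ zs × ys′ ↭ suc z ∷ zs × suc z ∈ ds
lower-one (raise r) = _ , _ , _ , keep r , refl , refl , here ≡.refl
lower-one (keep r) with _ , _ , _ , r′ , p , p′ , z∈ ← lower-one r =
  _ , _ , _ , keep r′ , trans (prep _ p) (swap _ _ refl) , trans (prep _ p′) (swap _ _ refl) , there z∈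

Raise-zero : Raise 0 ys ds → ys ≡ ds
Raise-zero [] = ≡.refl
Raise-zero (keep r) = cong (_ ∷_) (Raise-zero r)

-- ctx collects the entries already dealt with.  When a leading entry y is kept although some later
-- z is raised, z + 1 ≤ y, so `transfer` may move the raise from z to y.
raise-leading : ∀ ds → Raise k ys ds → AllPairs _≥_ ds → Realizable n (ys ++ ctx) →
  length (take k ds) ≡ k × All (0 <_) (take k ds) ×
  Realizable n ((map pred (take k ds) ++ drop k ds) ++ ctx)
raise-leading {k = zero} ds r _ g rewrite Raise-zero r = ≡.refl , [] , g
raise-leading {k = suc k} (suc y ∷ ds) (raise r) (_ ∷ ds↘) g
  with len , pos , g′ ← raise-leading ds r ds↘ (Realizable-↭ _ g (↭-sym (shift y _ _)))
  = cong suc len , z<s ∷ pos , Realizable-↭ _ g′ (shift y _ _)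
raise-leading {k = suc k} (y ∷ ds) (keep r) (y≥ds ∷ ds↘) g
  with z , zs , _ , r′ , p , p′ , z∈ds ← lower-one r
  -- `suc z ≤ y` also excludes `y = 0`, so this kept entry may be lowered.
  with y | All.lookup y≥ds z∈ds
... | suc y | s≤s z≤y
  with g′ ← Realizable-↭ _ (transfer (Realizable-↭ _ g (prep _ (++⁺ʳ _ p))) z≤y) (prep _ (++⁺ʳ _ (↭-sym p′)))
  with len , pos , g″ ← raise-leading ds r′ ds↘ (Realizable-↭ _ g′ (↭-sym (shift y _ _)))
  = cong suc len , z<s ∷ pos , Realizable-↭ _ g″ (shift y _ _)

-- Havel-Hakimi steps and trajectories.

nonincreasing-pairs : Nonincreasing ds → AllPairs _≥_ ds
nonincreasing-pairs = Linked⇒AllPairs λ y≤x z≤y → ≤-trans z≤y y≤x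

reduction-↭ : ∀ D ds → reduction (D ∷ ds) ↭ map pred (take D ds) ++ drop D ds
reduction-↭ D ds = sort-↭ _

havel-hakimi : ∀ {D} → Realizable (suc n) (D ∷ ds) → Nonincreasing (D ∷ ds) →
  length (take D ds) ≡ D × All (0 <_) (take D ds) × Realizable n (reduction (D ∷ ds))
havel-hakimi {n} {ds} {D} (add {ys = ys} r g) d↘ with _ ∷ ds↘ ← nonincreasing-pairs d↘
  with len , pos , g′ ← raise-leading {ctx = []} ds r ds↘ (subst (Realizable n) (≡.sym (List.++-identityʳ ys)) g)
  = len , pos , Realizable-↭ n (subst (Realizable n) (List.++-identityʳ _) g′) (↭-sym (reduction-↭ D ds))

record Admissible (d : List ℕ) : Set where
  constructor admissible
  field
    {size}        : ℕ
    realizable    : Realizable size d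
    nonincreasing : Nonincreasing d

Admissible-reduction : ∀ {d} → Admissible d → Admissible (reduction d)
Admissible-reduction {[]} adm = adm
Admissible-reduction {D ∷ ds} (admissible g@(add _ _) d↘) =
  admissible (proj₂ (proj₂ (havel-hakimi g d↘))) (sort-↗ (map pred (take D ds) ++ drop D ds))

Admissible-iterate : ∀ {d} → Admissible d → ∀ j → Admissible (d ^⟨ j ⟩)
Admissible-iterate adm zero    = adm
Admissible-iterate adm (suc j) = Admissible-reduction (Admissible-iterate adm j)

wellDefinedStep : ∀ {d} → Admissible d → 0 < pivot d → WellDefinedStep d
wellDefinedStep {D ∷ ds} (admissible g@(add _ _) d↘) D>0 with len , pos , _ ← havel-hakimi g d↘ = record
  { pivot-positive    = D>0
  ; selected-length   = len
  ; selected-positive = pos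
  }

-- `_^⟨_⟩` puts the last reduction outermost, whereas `stepsWithin` performs the first one and
-- recurses.
^-suc : ∀ d j → d ^⟨ suc j ⟩ ≡ reduction d ^⟨ j ⟩
^-suc d zero    = ≡.refl
^-suc d (suc j) = cong reduction (^-suc d j)

pivot-before : ∀ k d j → j < stepsWithin k d → 0 < pivot (d ^⟨ j ⟩)
pivot-before (suc k) (suc _ ∷ _)   zero    _         = z<s
pivot-before (suc k) d@(suc _ ∷ _) (suc j) (s≤s j<s) =
  subst (λ e → 0 < pivot e) (≡.sym (^-suc d j)) (pivot-before k (reduction d) j j<s)

-- Each reduction removes a vertex, so `k ≥ n` steps cannot run out while the pivot is positive;
-- without vertices the pivot is 0 by convention.
pivot-final : ∀ {k n d} → Realizable n d → Nonincreasing d → n ℕ.≤ k → pivot (d ^⟨ stepsWithin k d ⟩) ≡ 0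
pivot-final {zero}  []        _ _  = ≡.refl
pivot-final {zero}  (add _ _) _ ()
pivot-final {suc k} []        _ _  = ≡.refl
pivot-final {suc k} {d = zero ∷ _} (add _ _) _ _ = ≡.refl
pivot-final {suc k} {d = d@(suc D ∷ ds)} g@(add _ _) d↘ (s≤s n≤k)
  with _ , _ , g′ ← havel-hakimi g d↘ =
  ≡.trans (cong pivot (^-suc d (stepsWithin k (reduction d))))
          (pivot-final g′ (sort-↗ (map pred (take (suc D) ds) ++ drop (suc D) ds)) n≤k)

all-zero : All (0 ≥_) ds → ds ≡ replicate (zeros ds) 0
all-zero []         = ≡.refl
all-zero (z≤n ∷ ps) = cong (0 ∷_) (all-zero ps)

pivot-zero : Nonincreasing ds → pivot ds ≡ 0 → ds ≡ replicate (zeros ds) 0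
pivot-zero {[]} _ _ = ≡.refl
pivot-zero {zero ∷ _} d↘ _ with ps ∷ _ ← nonincreasing-pairs d↘ = all-zero (z≤n ∷ ps)

-- Finite sums and fractions.

∑-↭ : (f : ℕ → ℚ) → xs ↭ ys → ∑[ x ∈ xs ] f x ≡ ∑[ x ∈ ys ] f x
∑-↭ f refl         = ≡.refl
∑-↭ f (prep x p)   = cong (λ q → f x + q) (∑-↭ f p)
∑-↭ f (swap {xs} {ys} x y p) rewrite ∑-↭ f p =
  solve 3 (λ a b c → a :+ (b :+ c) := b :+ (a :+ c)) ≡.refl (f x) (f y) (∑[ z ∈ ys ] f z)
  where open +-*-Solver
∑-↭ f (trans p q)  = ≡.trans (∑-↭ f p) (∑-↭ f q)

∑-++ : ∀ (f : ℕ → ℚ) xs ys → (∑[ x ∈ xs ++ ys ] f x) ≡ (∑[ x ∈ xs ] f x) + (∑[ x ∈ ys ] f x)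
∑-++ f []       ys = ≡.sym (ℚ.+-identityˡ _)
∑-++ f (x ∷ xs) ys = ≡.trans (cong (λ q → f x + q) (∑-++ f xs ys)) (≡.sym (ℚ.+-assoc (f x) _ _))

∑-+ : ∀ {f g h : ℕ → ℚ} → All (λ x → f x ≡ g x + h x) xs →
      ∑[ x ∈ xs ] f x ≡ (∑[ x ∈ xs ] g x) + (∑[ x ∈ xs ] h x)
∑-+ [] = ≡.refl
∑-+ {x ∷ xs} {f} {g} {h} (eq ∷ eqs) = ≡.trans (cong₂ _+_ eq (∑-+ {f = f} {g} {h} eqs))
  (solve 4 (λ a b c d → a :+ b :+ (c :+ d) := a :+ c :+ (b :+ d)) ≡.refl
    (g x) (h x) (∑[ z ∈ xs ] g z) (∑[ z ∈ xs ] h z))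
  where open +-*-Solver

∑-nonneg : ∀ {f : ℕ → ℚ} → All (λ x → 0ℚ ≤ f x) xs → 0ℚ ≤ (∑[ x ∈ xs ] f x)
∑-nonneg         []       = ℚ.≤-refl
∑-nonneg {f = f} (p ∷ ps) = ℚ.+-mono-≤ p (∑-nonneg {f = f} ps)

÷-cong : ∀ i j m n .{{_ : NonZero m}} .{{_ : NonZero n}} → i ℤ.* + n ≡ j ℤ.* + m → i ÷ m ≡ j ÷ n
÷-cong i j (suc m) (suc n) eq = ℚ.fromℚᵘ-cong {mkℚᵘ i m} {mkℚᵘ j n} (*≡* eq)

-- On unnormalised representatives the equation is its cross-multiplied form, which the integer ring
-- solver can then treat.
÷-split : ∀ i j k m n p .{{_ : NonZero m}} .{{_ : NonZero n}} .{{_ : NonZero p}} →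
          k ℤ.* (+ m ℤ.* + n) ≡ (i ℤ.* + n ℤ.+ j ℤ.* + m) ℤ.* + p → k ÷ p ≡ i ÷ m + j ÷ n
÷-split i j k (suc m) (suc n) (suc p) eq = ℚ.toℚᵘ-injective (begin
  toℚᵘ (fromℚᵘ r)                          ≈⟨ ℚ.toℚᵘ-fromℚᵘ r ⟩
  r                                        ≈⟨ *≡* eq ⟩
  q₁ ℚᵘ.+ q₂                               ≈⟨ ℚᵘ.+-cong (ℚ.toℚᵘ-fromℚᵘ q₁) (ℚ.toℚᵘ-fromℚᵘ q₂) ⟨
  toℚᵘ (fromℚᵘ q₁) ℚᵘ.+ toℚᵘ (fromℚᵘ q₂)   ≈⟨ ℚ.toℚᵘ-homo-+ (fromℚᵘ q₁) (fromℚᵘ q₂) ⟨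
  toℚᵘ (fromℚᵘ q₁ + fromℚᵘ q₂)             ∎)
  where
  open import Relation.Binary.Reasoning.Setoid ℚᵘ.≃-setoid
  q₁ = mkℚᵘ i m
  q₂ = mkℚᵘ j n
  r  = mkℚᵘ k p

÷-nonneg : ∀ m n → 0ℚ ≤ + m ÷ n
÷-nonneg m zero    = ℚ.≤-refl
÷-nonneg m (suc n) = ℚ.nonNegative⁻¹ (+ m / suc n) {{ℚ.normalize-nonNeg m (suc n)}}

∑-const : ∀ n .{{_ : NonZero n}} xs → ∑[ x ∈ xs ] (1ℤ ÷ n) ≡ + length xs ÷ n
∑-const n [] = ÷-cong (+ 0) (+ 0) 1 n ≡.refl
∑-const n (x ∷ xs) = ≡.trans (cong (λ q → 1ℤ ÷ n + q) (∑-const n xs))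
  (≡.sym (÷-split 1ℤ (+ length xs) (+ suc (length xs)) n n n (identity (+ length xs) (+ n))))
  where
  identity : ∀ l n → (1ℤ ℤ.+ l) ℤ.* (n ℤ.* n) ≡ (1ℤ ℤ.* n ℤ.+ l ℤ.* n) ℤ.* n
  identity = ℤSolver.solve-∀

-- Effect of one reduction on the Caro-Wei sum.

pos-*-suc : ∀ x → + (x ℕ.* (x ℕ.+ 1)) ≡ + x ℤ.* (+ x ℤ.+ 1ℤ)
pos-*-suc x = ℤ.pos-* x (x ℕ.+ 1)

-- `suc (pred x)` is the denominator that `CW` gives to a lowered entry; positivity makes it `x`.
unit-split : ∀ {x} → 0 < x → 1ℤ / suc (pred x) ≡ 1ℤ / suc x + 1ℤ ÷ (x ℕ.* (x ℕ.+ 1))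
unit-split {x@(suc _)} _ = ÷-split 1ℤ 1ℤ 1ℤ (suc x) (x ℕ.* (x ℕ.+ 1)) x
  (subst (λ a → 1ℤ ℤ.* (+ suc x ℤ.* a) ≡ (1ℤ ℤ.* a ℤ.+ 1ℤ ℤ.* + suc x) ℤ.* + x)
         (≡.sym (pos-*-suc x)) (identity (+ x)))
  where
  identity : ∀ x → 1ℤ ℤ.* ((1ℤ ℤ.+ x) ℤ.* (x ℤ.* (x ℤ.+ 1ℤ))) ≡
                   (1ℤ ℤ.* (x ℤ.* (x ℤ.+ 1ℤ)) ℤ.+ 1ℤ ℤ.* (1ℤ ℤ.+ x)) ℤ.* x
  identity = ℤSolver.solve-∀

factoredTerm : ℕ → ℕ → ℚ
factoredTerm D x = ((+ D ℤ.- + x) ℤ.* + (D ℕ.+ x ℕ.+ 1)) ÷ (x ℕ.* (x ℕ.+ 1) ℕ.* D ℕ.* (D ℕ.+ 1))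

factored-split : ∀ {D x} → 0 < D → 0 < x →
                 1ℤ ÷ (x ℕ.* (x ℕ.+ 1)) ≡ factoredTerm D x + 1ℤ ÷ (D ℕ.* (D ℕ.+ 1))
factored-split {D@(suc _)} {x@(suc _)} _ _ = ÷-split i 1ℤ 1ℤ m b a eq
  where
  i = (+ D ℤ.- + x) ℤ.* + (D ℕ.+ x ℕ.+ 1)
  a = x ℕ.* (x ℕ.+ 1)
  b = D ℕ.* (D ℕ.+ 1)
  m = a ℕ.* D ℕ.* (D ℕ.+ 1)
  identity : ∀ D x → let a = x ℤ.* (x ℤ.+ 1ℤ); b = D ℤ.* (D ℤ.+ 1ℤ); m = a ℤ.* D ℤ.* (D ℤ.+ 1ℤ) in
    1ℤ ℤ.* (m ℤ.* b) ≡ ((D ℤ.- x) ℤ.* (D ℤ.+ x ℤ.+ 1ℤ) ℤ.* b ℤ.+ 1ℤ ℤ.* m) ℤ.* a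
  identity = ℤSolver.solve-∀
  eq : 1ℤ ℤ.* (+ m ℤ.* + b) ≡ (i ℤ.* + b ℤ.+ 1ℤ ℤ.* + m) ℤ.* + a
  eq rewrite ℤ.pos-* (a ℕ.* D) (D ℕ.+ 1) | ℤ.pos-* a D | pos-*-suc x | pos-*-suc D =
    identity (+ D) (+ x)

-- `x ≤ D` identifies the integer difference with the truncated one, so the numerator is a natural
-- number; over a zero denominator `÷` gives 0.
factored-nonneg : ∀ {D x} → x ℕ.≤ D → 0ℚ ≤ factoredTerm D x
factored-nonneg {D} {x} x≤D = subst (λ i → 0ℚ ≤ i ÷ (x ℕ.* (x ℕ.+ 1) ℕ.* D ℕ.* (D ℕ.+ 1)))
  (≡.trans (ℤ.pos-* (D ℕ.∸ x) (D ℕ.+ x ℕ.+ 1)) (cong (ℤ._* + (D ℕ.+ x ℕ.+ 1))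
     (≡.trans (≡.sym (ℤ.⊖-≥ x≤D)) (≡.sym (ℤ.m-n≡m⊖n D x)))))
  (÷-nonneg ((D ℕ.∸ x) ℕ.* (D ℕ.+ x ℕ.+ 1)) (x ℕ.* (x ℕ.+ 1) ℕ.* D ℕ.* (D ℕ.+ 1)))

gain-factored : ∀ {d} → WellDefinedStep d → gain d ≡ factoredGain d
gain-factored {d@(D@(suc _) ∷ ds)} step = begin
  (∑[ x ∈ s ] (1ℤ ÷ (x ℕ.* (x ℕ.+ 1)))) - 1ℤ / suc D
    ≡⟨ cong (_- 1ℤ / suc D) (∑-+ {g = factoredTerm D} {h = λ _ → 1ℤ ÷ (D ℕ.* (D ℕ.+ 1))}
         (All.map (factored-split z<s) selected-positive)) ⟩
  factoredGain d + (∑[ x ∈ s ] (1ℤ ÷ (D ℕ.* (D ℕ.+ 1)))) - 1ℤ / suc D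
    ≡⟨ cong (λ q → factoredGain d + q - 1ℤ / suc D) total ⟩
  factoredGain d + 1ℤ / suc D - 1ℤ / suc D
    ≡⟨ solve 2 (λ a b → a :+ b :- b := a) ≡.refl (factoredGain d) (1ℤ / suc D) ⟩
  factoredGain d ∎
  where
  open ≡-Reasoning
  open +-*-Solver
  open WellDefinedStep step
  s = selected d
  identity : ∀ D → D ℤ.* (1ℤ ℤ.+ D) ≡ 1ℤ ℤ.* (D ℤ.* (D ℤ.+ 1ℤ))
  identity = ℤSolver.solve-∀
  total : ∑[ x ∈ s ] (1ℤ ÷ (D ℕ.* (D ℕ.+ 1))) ≡ 1ℤ / suc D
  -- The count `selected-length` is essential: fewer than `D` copies would fall short of `1/(D+1)`.
  total rewrite ∑-const (D ℕ.* (D ℕ.+ 1)) s | selected-length =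
    ÷-cong (+ D) 1ℤ (D ℕ.* (D ℕ.+ 1)) (suc D)
      (≡.trans (identity (+ D)) (cong (1ℤ ℤ.*_) (≡.sym (pos-*-suc D))))

factoredGain-nonneg : ∀ {d} → Nonincreasing d → 0ℚ ≤ factoredGain d
factoredGain-nonneg {[]} _ = ℚ.≤-refl
factoredGain-nonneg {D ∷ ds} d↘ with D≥ds ∷ _ ← nonincreasing-pairs d↘ =
  ∑-nonneg (All.map factored-nonneg (take⁺ D D≥ds))

-- Sorting leaves the sum unchanged and the unselected tail cancels, so only the lowered entries and
-- the deleted pivot contribute.
CW-reduction : ∀ {d} → WellDefinedStep d → CW (reduction d) - CW d ≡ gain d
CW-reduction {d@(D@(suc _) ∷ ds)} step = begin
  CW (reduction d) - CW d
    ≡⟨ cong (_- CW d) (∑-↭ f (reduction-↭ D ds)) ⟩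
  CW (map pred s ++ r) - CW d
    ≡⟨ cong (_- CW d) (∑-++ f (map pred s) r) ⟩
  CW (map pred s) + CW r - CW d
    ≡⟨ cong₂ (λ p q → p + CW r - (1ℤ / suc D + q))
         (≡.trans (List.foldr-map (λ x acc → f x + acc) pred 0ℚ s)
           (∑-+ {g = f} {h = λ x → 1ℤ ÷ (x ℕ.* (x ℕ.+ 1))} (All.map unit-split selected-positive)))
         (≡.trans (cong CW (≡.sym (List.take++drop≡id D ds))) (∑-++ f s r)) ⟩
  CW s + G + CW r - (1ℤ / suc D + (CW s + CW r))
    ≡⟨ solve 4 (λ a b c e → a :+ b :+ c :- (e :+ (a :+ c)) := b :- e) ≡.refl (CW s) G (CW r) (1ℤ / suc D) ⟩
  gain d ∎
  where
  open ≡-Reasoning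
  open +-*-Solver
  open WellDefinedStep step
  s = selected d
  r = drop D ds
  f : ℕ → ℚ
  f x = 1ℤ / suc x
  G = ∑[ x ∈ s ] (1ℤ ÷ (x ℕ.* (x ℕ.+ 1)))

-- Telescoping along the trajectory.

telescope : ∀ (a g : ℕ → ℚ) n → (∀ j → j < n → a (suc j) - a j ≡ g j) →
            a n - a 0 ≡ ∑[ j ∈ upTo n ] g j
telescope a g zero    _  = ℚ.+-inverseʳ (a 0)
telescope a g (suc n) eq = begin
  a (suc n) - a 0
    -- `upTo` grows at its right end; the added `0ℚ` is the empty sum closing the sum over `n ∷ []`.
    ≡⟨ solve 3 (λ x y z → x :- z := y :- z :+ (x :- y :+ con 0ℚ)) ≡.refl (a (suc n)) (a n) (a 0) ⟩
  a n - a 0 + (a (suc n) - a n + 0ℚ)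
    ≡⟨ cong₂ (λ p q → p + (q + 0ℚ)) (telescope a g n λ j j<n → eq j (m<n⇒m<1+n j<n)) (eq n ≤-refl) ⟩
  (∑[ j ∈ upTo n ] g j) + (∑[ j ∈ n ∷ [] ] g j)
    ≡⟨ ∑-++ g (upTo n) (n ∷ []) ⟨
  ∑[ j ∈ upTo n ++ n ∷ [] ] g j
    ≡⟨ cong (λ js → ∑[ j ∈ js ] g j) (List.upTo-∷ʳ n) ⟩
  ∑[ j ∈ upTo (suc n) ] g j ∎
  where
  open ≡-Reasoning
  open +-*-Solver

CW-zeros : ∀ n → CW (replicate n 0) ≡ + n / 1
CW-zeros n = begin
  CW (replicate n 0) ≡⟨ CW-replicate n ⟩
  ∑[ x ∈ replicate n 0 ] (1ℤ ÷ 1) ≡⟨ ∑-const 1 (replicate n 0) ⟩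
  + length (replicate n 0) / 1 ≡⟨ cong (λ k → + k / 1) (List.length-replicate n) ⟩
  + n / 1 ∎
  where
  open ≡-Reasoning
  -- The summand of `CW` depends on the entry; it becomes a constant for `∑-const` only because
  -- every entry is 0.
  CW-replicate : ∀ n → CW (replicate n 0) ≡ ∑[ x ∈ replicate n 0 ] (1ℤ ÷ 1)
  CW-replicate zero    = ≡.refl
  CW-replicate (suc n) = cong (λ q → 1ℤ ÷ 1 + q) (CW-replicate n)

lemma9 : (d : List ℕ) → Graphic d → Nonincreasing d → 0 < pivot d →
    WellDefinedStep d
    × (CW (reduction d) - CW d ≡ gain d)
    × (0ℚ ≤ gain d)
    × (CW (reduction d) - CW d ≡ factoredGain d)
    × (∀ j → j < steps d → WellDefinedStep (d ^⟨ j ⟩))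
    × (d ^⟨ steps d ⟩ ≡ replicate (R d) 0)
    × (+ R d / 1 - CW d ≡ ∑[ j ∈ upTo (steps d) ] gain (d ^⟨ j ⟩))
lemma9 d graphic d↘ D>0 =
  -- Nonnegativity is read off the factored form, term by term.
  step , CW-reduction step , subst (0ℚ ≤_) (≡.sym (gain-factored step)) (factoredGain-nonneg d↘) ,
  ≡.trans (CW-reduction step) (gain-factored step) , step-at , final , total
  where
  g : Realizable (length d) d
  g = graphic-realizable graphic

  start : Admissible d
  start = admissible g d↘

  step : WellDefinedStep d
  step = wellDefinedStep start D>0

  step-at : ∀ j → j < steps d → WellDefinedStep (d ^⟨ j ⟩)
  step-at j j<s = wellDefinedStep (Admissible-iterate start j) (pivot-before (length d) d j j<s)

  final : d ^⟨ steps d ⟩ ≡ replicate (R d) 0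
  final = pivot-zero (Admissible.nonincreasing (Admissible-iterate start (steps d))) (pivot-final g d↘ ≤-refl)

  total : + R d / 1 - CW d ≡ ∑[ j ∈ upTo (steps d) ] gain (d ^⟨ j ⟩)
  total = ≡.trans
    -- Each final zero weighs 1, so `R d` is the Caro-Wei sum of the last sequence.
    (cong (_- CW d) (≡.trans (≡.sym (CW-zeros (R d))) (cong CW (≡.sym final))))
    (telescope (λ j → CW (d ^⟨ j ⟩)) (λ j → gain (d ^⟨ j ⟩)) (steps d) λ j j<s → CW-reduction (step-at j j<s))
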